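{- Let $\Sigma$ be a finite alphabet. For every unranked ordered $\Sigma$-labeled tree $t$, $|\mathrm{hdag}(t)| \le \min(|\mathrm{dag}(t)|, |\mathrm{bdag}(t)|)$.
   Context: An unranked tree over $\Sigma$ is a finite rooted tree with nodes labeled in $\Sigma$ and linearly ordered children (arbitrary finite number). Size means number of edges. $\mathrm{dag}(t)$ is the minimal dag of $t$: its nodes are the distinct subtrees of $t$, and the node of a subtree $f(s_1,\dots,s_k)$ has $k$ ordered edges to the nodes of $s_1,\dots,s_k$; thus $|\mathrm{dag}(t)|$ equals the sum, over all distinct subtrees $s$ of $t$, of the number of children of the root of $s$. The first-child/next-sibling encoding $\mathrm{fcns}$ maps a sequence of unranked trees to a binary tree (each node has an optional left and optional right child): $\mathrm{fcns}(\varepsilon)$ is empty and $\mathrm{fcns}(t_1t_2\cdots t_n)=f(\mathrm{fcns}(u_1\cdots u_m),\mathrm{fcns}(t_2\cdots t_n))$ when $t_1=f(u_1,\dots,u_m)$ (left child = first child, right child = next sibling). $\mathrm{bdag}(t)$ is the minimal dag of $\mathrm{fcns}(t)$ (identical subtrees merged), and $|\mathrm{bdag}(t)|$ its number of edges (edges to absent children are not counted). Hybrid dag: for each distinct subtree $s=f(s_1,\dots,s_k)$ of $t$ with $k\ge1$ introduce a fresh symbol $A_s$ and the height-one tree $\rho_s=f(\alpha_1,\dots,\alpha_k)$, where $\alpha_i$ is the label of $s_i$ if $s_i$ is a single node and $\alpha_i=A_{s_i}$ otherwise (the $\alpha_i$ are leaves). Let $\rho'_s$ be $\rho_s$ with its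 root additionally marked by $A_s$. Then $\mathrm{hdag}(t)$ is the minimal dag of the forest consisting of the binary trees $\mathrm{fcns}(\rho'_s)$ (identical subtrees anywhere in the forest are merged), and $|\mathrm{hdag}(t)|$ is its number of edges (edges to absent children not counted). -}

module Defs where

open import Data.Empty using (⊥)
open import Data.List.Base
  using (List; []; _∷_; [_]; _++_; map; concatMap; length; zip; upTo; filter; deduplicate)
open import Data.Nat.Base using (ℕ)
open import Data.Nat.ListAction using (sum)
open import Data.Product.Base using (_×_; _,_; uncurry)
open import Data.Unit.Base using (⊤; tt)
open import Data.Tree.Binary using (leaf; node) renaming (Tree to LTree)
open import Data.Fin.Base using (Fin)
open import Data.Fin.Properties using (inj⇒≟)
open import Function.Base using (_∘_)
open import Function.Bundles using (_↔_)
open import Function.Properties.Inverse using (↔⇒↣)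
open import Level using (Level; _⊔_)
open import Relation.Binary.Definitions using (DecidableEquality)
open import Relation.Binary.PropositionalEquality.Core using (refl; cong; cong₂)
open import Relation.Nullary using (Dec; yes; no)
open import Relation.Nullary.Decidable using (map′; _×-dec_)

private
  variable
    a b : Level
    A : Set a

≟-fromFinite : ∀ {n} → A ↔ Fin n → DecidableEquality A
≟-fromFinite enum = inj⇒≟ (↔⇒↣ enum)

-- The library's Data.Tree.Rose is sized, hence unavailable under --safe.
data Tree (A : Set a) : Set a where
  _⟨_⟩ : A → List (Tree A) → Tree A

module _ {A : Set a} (_≟_ : DecidableEquality A) where

  ≟-tree   : DecidableEquality (Tree A)
  ≟-forest : DecidableEquality (List (Tree A))

  ≟-tree (f ⟨ ts ⟩) (g ⟨ us ⟩) =
    map′ (uncurry (cong₂ _⟨_⟩)) (λ { refl → refl , refl }) ((f ≟ g) ×-dec ≟-forest ts us)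

  ≟-forest []       []       = yes refl
  ≟-forest []       (_ ∷ _)  = no λ ()
  ≟-forest (_ ∷ _)  []       = no λ ()
  ≟-forest (t ∷ ts) (u ∷ us) =
    map′ (uncurry (cong₂ _∷_)) (λ { refl → refl , refl }) (≟-tree t u ×-dec ≟-forest ts us)

children : Tree A → List (Tree A)
children (_ ⟨ ts ⟩) = ts

subtrees       : Tree A → List (Tree A)
forestSubtrees : List (Tree A) → List (Tree A)

subtrees (f ⟨ ts ⟩) = (f ⟨ ts ⟩) ∷ forestSubtrees ts

forestSubtrees []       = []
forestSubtrees (t ∷ ts) = subtrees t ++ forestSubtrees ts

-- `leaf tt` is an absent child (the empty tree), not a node.
Binary : Set a → Set a
Binary A = LTree A ⊤

≟-binary : DecidableEquality A → DecidableEquality (Binary A)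
≟-binary _≟_ (leaf tt)    (leaf tt)    = yes refl
≟-binary _≟_ (leaf _)     (node _ _ _) = no λ ()
≟-binary _≟_ (node _ _ _) (leaf _)     = no λ ()
≟-binary _≟_ (node l x r) (node m y s) =
  map′ (λ { (refl , refl , refl) → refl }) (λ { refl → refl , refl , refl })
       (≟-binary _≟_ l m ×-dec ((x ≟ y) ×-dec ≟-binary _≟_ r s))

binarySubtrees : Binary A → List (Binary A)
binarySubtrees (leaf _)     = []
binarySubtrees (node l x r) = node l x r ∷ binarySubtrees l ++ binarySubtrees r

fcns : List (Tree A) → Binary A
fcns []                = leaf tt
fcns ((f ⟨ us ⟩) ∷ ts) = node (fcns us) f (fcns ts)

-- Nodes are taken from a type V of trees, so that node labels need not be
-- stored; `edges v` lists the outgoing edges of v as pairs of a position in P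
-- and a target. Only the values of `edges` on `nodes` matter.
record Dag (P : Set a) (V : Set b) : Set (a ⊔ b) where
  field
    nodes : List V
    edges : V → List (P × V)

  size : ℕ
  size = sum (map (length ∘ edges) nodes)

open Dag public using (size)

data Side : Set where
  left right : Side

presentChild : Side → Binary A → List (Side × Binary A)
presentChild d (leaf _)       = []
presentChild d t@(node _ _ _) = [ d , t ]

binaryEdges : Binary A → List (Side × Binary A)
binaryEdges (leaf _)     = []
binaryEdges (node l _ r) = presentChild left l ++ presentChild right r

minimalBinaryDag : DecidableEquality A → List (Binary A) → Dag Side (Binary A)
minimalBinaryDag _≟_ ts = record
  { nodes = deduplicate (≟-binary _≟_) (concatMap binarySubtrees ts)
  ; edges = binaryEdges
  }

-- `nonterminal s` is the fresh symbol A_s, and `f markedBy s` is the letter f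
-- with the additional mark A_s.
data Symbol (A : Set a) : Set a where
  terminal    : A → Symbol A
  nonterminal : Tree A → Symbol A
  _markedBy_  : A → Tree A → Symbol A

≟-symbol : DecidableEquality A → DecidableEquality (Symbol A)
≟-symbol _≟_ (terminal f)     (terminal g)     = map′ (cong terminal) (λ { refl → refl }) (f ≟ g)
≟-symbol _≟_ (nonterminal s)  (nonterminal t)  =
  map′ (cong nonterminal) (λ { refl → refl }) (≟-tree _≟_ s t)
≟-symbol _≟_ (f markedBy s)   (g markedBy t)   =
  map′ (uncurry (cong₂ _markedBy_)) (λ { refl → refl , refl }) ((f ≟ g) ×-dec ≟-tree _≟_ s t)
≟-symbol _≟_ (terminal _)     (nonterminal _)  = no λ ()
≟-symbol _≟_ (terminal _)     (_ markedBy _)   = no λ ()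
≟-symbol _≟_ (nonterminal _)  (terminal _)     = no λ ()
≟-symbol _≟_ (nonterminal _)  (_ markedBy _)   = no λ ()
≟-symbol _≟_ (_ markedBy _)   (terminal _)     = no λ ()
≟-symbol _≟_ (_ markedBy _)   (nonterminal _)  = no λ ()

α : Tree A → Symbol A
α (f ⟨ [] ⟩)      = terminal f
α s@(_ ⟨ _ ∷ _ ⟩) = nonterminal s

ρ′ : Tree A → Tree (Symbol A)
ρ′ s@(f ⟨ ss ⟩) = (f markedBy s) ⟨ map (λ u → α u ⟨ [] ⟩) ss ⟩

HasChild : Tree A → Set
HasChild (_ ⟨ [] ⟩)    = ⊥
HasChild (_ ⟨ _ ∷ _ ⟩) = ⊤

hasChild? : (t : Tree A) → Dec (HasChild t)
hasChild? (_ ⟨ [] ⟩)    = no λ ()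
hasChild? (_ ⟨ _ ∷ _ ⟩) = yes tt

module _ {A : Set a} (_≟_ : DecidableEquality A) where

  distinctSubtrees : Tree A → List (Tree A)
  distinctSubtrees t = deduplicate (≟-tree _≟_) (subtrees t)

  dag : Tree A → Dag ℕ (Tree A)
  dag t = record
    { nodes = distinctSubtrees t
    ; edges = λ s → zip (upTo (length (children s))) (children s)
    }

  bdag : Tree A → Dag Side (Binary A)
  bdag t = minimalBinaryDag _≟_ [ fcns [ t ] ]

  hdag : Tree A → Dag Side (Binary (Symbol A))
  hdag t = minimalBinaryDag (≟-symbol _≟_)
    (map (λ s → fcns [ ρ′ s ]) (filter hasChild? (distinctSubtrees t)))

{-# OPTIONS --safe #-}

-- Every edge of the hybrid dag is either a root edge, determined by an inner
-- subtree s, or a sibling edge, determined by a sibling list u ∷ v ∷ ws that is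
-- a suffix of the children of some subtree s.  Both kinds are read off from
-- edges of dag(t): the first edge of s gives the root edge of s, and its edge
-- number j + 1 gives the sibling edge of the suffix starting at child j.  They
-- are also read off from edges of bdag(t): a left edge out of fcns (s ∷ ws)
-- gives the root edge of s, a right edge out of fcns (u ∷ v ∷ ws) gives the
-- sibling edge.  As the edges of the hybrid dag are pairwise distinct, there
-- are no more of them than edges that they can be read off from.
module Submission where

open import Defs
open import Data.Fin.Base using (Fin)
open import Data.List.Base
  using (List; []; _∷_; [_]; _++_; map; concatMap; length; zip; applyUpTo; drop)
open import Data.List.Membership.Propositional using (_∈_; find; lose)
open import Data.List.Membership.Propositional.Properties
open import Data.List.Properties using (length-++; length-map)
open import Data.List.Relation.Binary.Disjoint.Propositional using (Disjoint)
open import Data.List.Relation.Binary.Subset.Propositional using (_⊆_)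
import Data.List.Relation.Unary.All as All
open import Data.List.Relation.Unary.AllPairs using ([]; _∷_)
open import Data.List.Relation.Unary.Any using (here; there)
open import Data.List.Relation.Unary.Any.Properties using (map⁻)
open import Data.List.Relation.Unary.Unique.DecPropositional.Properties using (deduplicate-!)
open import Data.List.Relation.Unary.Unique.Propositional using (Unique)
open import Data.List.Relation.Unary.Unique.Propositional.Properties using (map⁺; ++⁺)
open import Data.Nat.Base using (ℕ; zero; suc; _+_; _≤_; _⊓_; z≤n; s≤s)
open import Data.Nat.ListAction using (sum)
open import Data.Nat.Properties using (+-suc; ⊓-glb; module ≤-Reasoning)
open import Data.Product.Base using (_×_; _,_; ∃-syntax; proj₁; proj₂)
open import Data.Sum.Base using (inj₁; inj₂)
open import Data.Tree.Binary using (leaf; node)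
open import Function.Base using (id; _∘_)
open import Function.Bundles using (_↔_)
open import Level using (Level)
open import Relation.Binary.Definitions using (DecidableEquality)
open import Relation.Binary.PropositionalEquality
  using (_≡_; _≢_; refl; trans; cong; cong₂; subst)
open import Relation.Nullary using (contradiction)

private
  variable
    a b c d : Level
    A : Set a
    P : Set a
    Q : Set b
    V : Set c
    W : Set d

∈-++-remove : ∀ (us : List A) {x y vs} → y ∈ us ++ x ∷ vs → x ≢ y → y ∈ us ++ vs
∈-++-remove us y∈ x≢y with ∈-++⁻ us y∈
... | inj₁ y∈us         = ∈-++⁺ˡ y∈us
... | inj₂ (here refl)  = contradiction refl x≢y
... | inj₂ (there y∈vs) = ∈-++⁺ʳ us y∈vs

-- Pigeonhole by induction on `xs`: cut one occurrence of `x` out of `ys`. The other entries of `xs`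
-- differ from `x`, so they survive the cut.
Unique-⊆⇒length-≤ : ∀ {xs ys : List A} → Unique xs → xs ⊆ ys → length xs ≤ length ys
Unique-⊆⇒length-≤ [] xs⊆ys = z≤n
Unique-⊆⇒length-≤ {xs = x ∷ xs} (x∉xs ∷ xs!) x∷xs⊆ys
  with us , vs , refl ← ∈-∃++ (x∷xs⊆ys (here refl)) = begin
  suc (length xs)             ≤⟨ s≤s (Unique-⊆⇒length-≤ xs! xs⊆us++vs) ⟩
  suc (length (us ++ vs))     ≡⟨ cong suc (length-++ us) ⟩
  suc (length us + length vs) ≡⟨ +-suc (length us) (length vs) ⟨
  length us + suc (length vs) ≡⟨ length-++ us ⟨
  length (us ++ x ∷ vs)       ∎
  where
  open ≤-Reasoning
  xs⊆us++vs : xs ⊆ us ++ vs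
  xs⊆us++vs y∈xs = ∈-++-remove us (x∷xs⊆ys (there y∈xs)) (All.lookup x∉xs y∈xs)

module _ (f : V → List P) where

  -- Pairing each edge with its source turns a size, which is a sum of out-degrees, into the length
  -- of a single list.
  labelled : List V → List (V × P)
  labelled = concatMap (λ v → map (v ,_) (f v))

  ∈-labelled⁺ : ∀ {v p vs} → v ∈ vs → p ∈ f v → (v , p) ∈ labelled vs
  ∈-labelled⁺ v∈vs p∈fv = ∈-concatMap⁺ _ (lose v∈vs (∈-map⁺ _ p∈fv))

  ∈-labelled⁻ : ∀ {v p} vs → (v , p) ∈ labelled vs → v ∈ vs × p ∈ f v
  ∈-labelled⁻ vs vp∈
    with u , u∈vs , vp∈u ← find (∈-concatMap⁻ _ {xs = vs} vp∈)
    with p , p∈fu , refl ← ∈-map⁻ _ vp∈u = u∈vs , p∈fu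

  labelled-! : (∀ v → Unique (f v)) → ∀ {vs} → Unique vs → Unique (labelled vs)
  labelled-! f! [] = []
  labelled-! f! (_∷_ {x = v} {xs = vs} v∉vs vs!) =
    ++⁺ (map⁺ (cong proj₂) (f! v)) (labelled-! f! vs!) disjoint
    where
    disjoint : Disjoint (map (v ,_) (f v)) (labelled vs)
    disjoint {_ , p} (e∈v , e∈vs) with _ , _ , refl ← ∈-map⁻ (v ,_) e∈v =
      All.lookup v∉vs (proj₁ (∈-labelled⁻ vs e∈vs)) refl

  length-labelled : ∀ vs → length (labelled vs) ≡ sum (map (length ∘ f) vs)
  length-labelled []       = refl
  length-labelled (v ∷ vs) = trans (length-++ (map (v ,_) (f v)))
    (cong₂ _+_ (length-map (v ,_) (f v)) (length-labelled vs))

arrows : Dag P V → List (V × P × V)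
arrows D = labelled (Dag.edges D) (Dag.nodes D)

-- The map `g` runs from `E` back to `D`: to cover the pairwise distinct arrows of `D`, at least as
-- many arrows of `E` are required.
size-≤ : (D : Dag P V) (E : Dag Q W) →
         Unique (Dag.nodes D) → (∀ v → Unique (Dag.edges D v)) →
         (g : W × Q × W → V × P × V) → arrows D ⊆ map g (arrows E) →
         size D ≤ size E
size-≤ D E nodes! edges! g D⊆gE = begin
  size D                    ≡⟨ length-labelled (Dag.edges D) (Dag.nodes D) ⟨
  length (arrows D)         ≤⟨ Unique-⊆⇒length-≤ (labelled-! _ edges! nodes!) D⊆gE ⟩
  length (map g (arrows E)) ≡⟨ length-map g (arrows E) ⟩
  length (arrows E)         ≡⟨ length-labelled (Dag.edges E) (Dag.nodes E) ⟩
  size E                    ∎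
  where open ≤-Reasoning

binaryEdges-! : (v : Binary A) → Unique (binaryEdges v)
binaryEdges-! (leaf _)                           = []
binaryEdges-! (node (leaf _)     _ (leaf _))     = []
binaryEdges-! (node (leaf _)     _ (node _ _ _)) = All.[] ∷ []
binaryEdges-! (node (node _ _ _) _ (leaf _))     = All.[] ∷ []
binaryEdges-! (node (node _ _ _) _ (node _ _ _)) = ((λ ()) All.∷ All.[]) ∷ All.[] ∷ []

binarySubtrees-trans : ∀ {v u} (b : Binary A) →
  v ∈ binarySubtrees u → u ∈ binarySubtrees b → v ∈ binarySubtrees b
binarySubtrees-trans (node l x r) v∈u (here refl) = v∈u
binarySubtrees-trans (node l x r) v∈u (there u∈) with ∈-++⁻ (binarySubtrees l) u∈
... | inj₁ u∈l = there (∈-++⁺ˡ (binarySubtrees-trans l v∈u u∈l))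
... | inj₂ u∈r = there (∈-++⁺ʳ (binarySubtrees l) (binarySubtrees-trans r v∈u u∈r))

-- Left inverse of `fcns`, by which trees are recovered from the nodes of `bdag`.
unfcns : Binary A → List (Tree A)
unfcns (leaf _)     = []
unfcns (node l x r) = x ⟨ unfcns l ⟩ ∷ unfcns r

unfcns-fcns : (ts : List (Tree A)) → unfcns (fcns ts) ≡ ts
unfcns-fcns []              = refl
unfcns-fcns (f ⟨ us ⟩ ∷ ts) = cong₂ (λ us ts → f ⟨ us ⟩ ∷ ts) (unfcns-fcns us) (unfcns-fcns ts)

-- A node of the encoding carries its right siblings along; `ws` are those of the occurrence that
-- the membership proof points to.
fcns-subtree : ∀ {s} (ts : List (Tree A)) → s ∈ forestSubtrees ts →
               ∃[ ws ] fcns (s ∷ ws) ∈ binarySubtrees (fcns ts)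
fcns-subtree (f ⟨ us ⟩ ∷ ts) (here refl) = ts , here refl
fcns-subtree (f ⟨ us ⟩ ∷ ts) (there s∈) with ∈-++⁻ (forestSubtrees us) s∈
... | inj₁ s∈us with ws , ∈us ← fcns-subtree us s∈us = ws , there (∈-++⁺ˡ ∈us)
... | inj₂ s∈ts with ws , ∈ts ← fcns-subtree ts s∈ts =
  ws , there (∈-++⁺ʳ (binarySubtrees (fcns us)) ∈ts)

fcns-drop : ∀ j (ts : List (Tree A)) {u us} → drop j ts ≡ u ∷ us →
            fcns (u ∷ us) ∈ binarySubtrees (fcns ts)
fcns-drop zero    (f ⟨ us ⟩ ∷ ts) refl = here refl
fcns-drop (suc j) (f ⟨ us ⟩ ∷ ts) eq   =
  there (∈-++⁺ʳ (binarySubtrees (fcns us)) (fcns-drop j ts eq))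

drop-tail : ∀ j (xs : List A) {y ys} → drop j xs ≡ y ∷ ys → drop (suc j) xs ≡ ys
drop-tail zero    (x ∷ xs) refl = refl
drop-tail (suc j) (x ∷ xs) eq   = drop-tail j xs eq

-- Stated for arbitrary `f` since the recursion replaces `f` by `f ∘ suc`; `upTo` is the case `id`.
∈-zip-applyUpTo : ∀ (f : ℕ → V) j (xs : List A) {y ys} → drop j xs ≡ y ∷ ys →
                  (f j , y) ∈ zip (applyUpTo f (length xs)) xs
∈-zip-applyUpTo f zero    (x ∷ xs) refl = here refl
∈-zip-applyUpTo f (suc j) (x ∷ xs) eq   = there (∈-zip-applyUpTo (f ∘ suc) j xs eq)

siblings : List (Tree A) → Binary (Symbol A)
siblings ts = fcns (map (λ u → α u ⟨ [] ⟩) ts)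

HybridArrow : Set a → Set a
HybridArrow A = Binary (Symbol A) × Side × Binary (Symbol A)

rootArrow : Tree A → HybridArrow A
rootArrow s = fcns [ ρ′ s ] , left , siblings (children s)

siblingArrow : List (Tree A) → HybridArrow A
siblingArrow ts = siblings ts , right , siblings (drop 1 ts)

-- The arrow in `sibling` depends on the suffix alone, as equal suffixes are merged; `s` and `j`
-- record one occurrence from which it can be read off.
data IsHybridArrow {A : Set a} (t : Tree A) : HybridArrow A → Set a where
  root    : ∀ {s u us} → s ∈ subtrees t → children s ≡ u ∷ us →
            IsHybridArrow t (rootArrow s)
  sibling : ∀ {s u v ws} → s ∈ subtrees t → ∀ j → drop j (children s) ≡ u ∷ v ∷ ws →
            IsHybridArrow t (siblingArrow (u ∷ v ∷ ws))

-- All trees encoded by `siblings` are single nodes, so left children are absent and every node lies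
-- on the right spine.
binarySubtrees-siblings : ∀ {v} (ts : List (Tree A)) → v ∈ binarySubtrees (siblings ts) →
  ∃[ j ] ∃[ u ] ∃[ us ] drop j ts ≡ u ∷ us × v ≡ siblings (u ∷ us)
binarySubtrees-siblings (t ∷ ts) (here refl) = 0 , t , ts , refl , refl
binarySubtrees-siblings (t ∷ ts) (there v∈)
  with j , u , us , eq , refl ← binarySubtrees-siblings ts v∈ = suc j , u , us , eq , refl

-- The marked root has no sibling, hence at most a left edge; every other node is childless in
-- `ρ′ s`, hence has at most a right edge.
binaryEdges-ρ′ : ∀ {t : Tree A} {v e} s → s ∈ subtrees t →
  v ∈ binarySubtrees (fcns [ ρ′ s ]) → e ∈ binaryEdges v → IsHybridArrow t (v , e)
binaryEdges-ρ′ (f ⟨ [] ⟩)     s∈t (here refl) ()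
binaryEdges-ρ′ (f ⟨ u ∷ us ⟩) s∈t (here refl) (here refl) = root s∈t refl
binaryEdges-ρ′ s@(f ⟨ ss ⟩)   s∈t (there v∈)  e∈v
  with ∈-++⁻ (binarySubtrees (siblings ss)) v∈
... | inj₁ v∈ss with binarySubtrees-siblings ss v∈ss | e∈v
...   | j , u , v ∷ ws , eq , refl | here refl = sibling s∈t j eq

module _ {A : Set a} (_≟_ : DecidableEquality A) (t : Tree A) where

  hdag-arrows : ∀ {e} → e ∈ arrows (hdag _≟_ t) → IsHybridArrow t e
  hdag-arrows {v , e} ve∈
    with v∈ , e∈v ← ∈-labelled⁻ binaryEdges (Dag.nodes (hdag _≟_ t)) ve∈
    with s , s∈filter , v∈s ← find (map⁻ (∈-concatMap⁻ binarySubtrees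
           (∈-deduplicate⁻ (≟-binary (≟-symbol _≟_)) _ v∈)))
    = binaryEdges-ρ′ s
        (∈-deduplicate⁻ (≟-tree _≟_) (subtrees t) (proj₁ (∈-filter⁻ hasChild? s∈filter))) v∈s e∈v

  hdag-size-≤ : (E : Dag Q W) (g : W × Q × W → HybridArrow A) →
    (∀ {e} → IsHybridArrow t e → e ∈ map g (arrows E)) → size (hdag _≟_ t) ≤ size E
  hdag-size-≤ E g covers = size-≤ (hdag _≟_ t) E
    (deduplicate-! (≟-binary (≟-symbol _≟_)) _) binaryEdges-! g (covers ∘ hdag-arrows)

  hdag≤dag : size (hdag _≟_ t) ≤ size (dag _≟_ t)
  hdag≤dag = hdag-size-≤ (dag _≟_ t) decode covers
    where
    decode : Tree A × ℕ × Tree A → HybridArrow A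
    decode (s , zero  , _) = rootArrow s
    -- Edge number `suc j` ends at the second tree of the suffix starting at child `j`, so it exists
    -- exactly when that suffix has at least two trees.
    decode (s , suc j , _) = siblingArrow (drop j (children s))

    arrow : ∀ {s} → s ∈ subtrees t → ∀ j {u us} → drop j (children s) ≡ u ∷ us →
            decode (s , j , u) ∈ map decode (arrows (dag _≟_ t))
    arrow s∈t j eq = ∈-map⁺ decode (∈-labelled⁺ _ (∈-deduplicate⁺ (≟-tree _≟_) s∈t)
      (∈-zip-applyUpTo id j _ eq))

    covers : ∀ {e} → IsHybridArrow t e → e ∈ map decode (arrows (dag _≟_ t))
    covers (root s∈t eq)      = arrow s∈t 0 eq
    covers (sibling s∈t j eq) = subst (λ ts → siblingArrow ts ∈ _) eq
      (arrow s∈t (suc j) (drop-tail j _ eq))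

  hdag≤bdag : size (hdag _≟_ t) ≤ size (bdag _≟_ t)
  hdag≤bdag = hdag-size-≤ (bdag _≟_ t) decode covers
    where
    -- A leaf has no edges, so its image under decode is a junk value.
    decode : Binary A × Side × Binary A → HybridArrow A
    decode (leaf _     , left  , _) = siblingArrow []
    -- The label and the left subtree determine `s`; the right subtree varies with the occurrence of
    -- `s` and is dropped.
    decode (node l x _ , left  , _) = rootArrow (x ⟨ unfcns l ⟩)
    decode (v          , right , _) = siblingArrow (unfcns v)

    arrow : ∀ {v e} → v ∈ binarySubtrees (fcns [ t ]) → e ∈ binaryEdges v →
            decode (v , e) ∈ map decode (arrows (bdag _≟_ t))
    arrow v∈ e∈v = ∈-map⁺ decode (∈-labelled⁺ _
      (∈-deduplicate⁺ (≟-binary _≟_) (∈-++⁺ˡ v∈)) e∈v)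

    occurs : ∀ {s} → s ∈ subtrees t → ∃[ ws ] fcns (s ∷ ws) ∈ binarySubtrees (fcns [ t ])
    occurs s∈t = fcns-subtree [ t ] (∈-++⁺ˡ s∈t)

    covers : ∀ {e} → IsHybridArrow t e → e ∈ map decode (arrows (bdag _≟_ t))
    -- Exposing the first child as `g ⟨ vs ⟩` makes its encoding reduce to a `node`, so that the
    -- left edge is present.
    covers (root {s = f ⟨ (g ⟨ vs ⟩) ∷ us ⟩} s∈t refl) =
      subst (λ ts → rootArrow (f ⟨ ts ⟩) ∈ map decode (arrows (bdag _≟_ t))) (unfcns-fcns (g ⟨ vs ⟩ ∷ us))
        (arrow (proj₂ (occurs s∈t)) (here refl))
    covers (sibling {s = f ⟨ ss ⟩} {u = g ⟨ vs ⟩} {v = h ⟨ _ ⟩} {ws = ws} s∈t j eq) =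
      subst (λ ts → siblingArrow ts ∈ map decode (arrows (bdag _≟_ t))) (unfcns-fcns (g ⟨ vs ⟩ ∷ _ ∷ ws))
        -- The suffix lies on the right spine of the left subtree of the node for `s`. Its right
        -- edge comes after a left edge that is present only if `vs` is nonempty.
        (arrow (binarySubtrees-trans (fcns [ t ]) suffix∈s (proj₂ (occurs s∈t)))
               (∈-++⁺ʳ (presentChild left (fcns vs)) (here refl)))
      where
      suffix∈s : _ ∈ binarySubtrees (fcns (f ⟨ ss ⟩ ∷ proj₁ (occurs s∈t)))
      suffix∈s = there (∈-++⁺ˡ (fcns-drop j ss eq))

theorem1 : ∀ {a} {Σ : Set a} {n : ℕ} (finite : Σ ↔ Fin n) (t : Tree Σ) →
    let _≟_ = ≟-fromFinite finite in
    size (hdag _≟_ t) ≤ size (dag _≟_ t) ⊓ size (bdag _≟_ t)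
theorem1 finite t = ⊓-glb (hdag≤dag (≟-fromFinite finite) t) (hdag≤bdag (≟-fromFinite finite) t)
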